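{- Every graph $G$ of order at most seven satisfies \[ \tau_D(G)\le\frac{\Delta(\Delta-1)n+2m}{\Delta^2+1}, \] where $n,m,\Delta$ are the order, size and maximum degree of $G$. Consequently, the graph $H_{2,2}$, which has order eight and violates this inequality, has minimum possible order among all graphs violating the inequality.
   Context: All graphs are finite, simple and undirected (not necessarily connected); the maximum degree of the null graph is taken to be zero. A set $T\subseteq V(G)$ is an identifying vertex cover if $e\cap T\neq\emptyset$ for every $e\in E(G)$ and the sets $e\cap T$ ($e\in E(G)$) are pairwise distinct; $\tau_D(G)$ is the minimum cardinality of an identifying vertex cover of $G$. $H_{2,2}$ is the graph on the eight distinct vertices $a,b,x_1,x_2,c_1,c_2,d_1,d_2$ with exactly the eleven edges $ax_1,\ ax_2,\ bx_1,\ bx_2,\ ac_1,\ ac_2,\ c_1d_1,\ c_2d_2,\ d_1b,\ d_2b,\ d_1d_2$. -}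

module Defs where

open import Data.Bool.Properties using () renaming (_≟_ to _≟ᵇ_)
open import Data.Fin using (Fin; _<_; _<?_; #_)
open import Data.Fin.Properties using (<-irrefl; <-asym) renaming (_≟_ to _≟ᶠ_)
open import Data.Fin.Subset
  using (Subset; inside; outside; ⁅_⁆; _∩_; _∪_; ∣_∣; Nonempty; ⊤)
  renaming (_∈_ to _∈ˢ_)
open import Data.Fin.Subset.Properties
  using (nonempty?; ∣⊤∣≡n; ∩-identityʳ; x∈⁅x⁆; x∈⁅y⁆⇒x≡y; x∈p∪q⁺; x∈p∪q⁻)
open import Data.Integer using (ℤ; +_; _+_; _-_; _*_)
open import Data.List using (List; []; _∷_; _++_; map; filter; length; allFin; cartesianProduct)
open import Data.List.Extrema.Nat using (min; max; argmin-sel; min≤xs)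
open import Data.List.Membership.Propositional using (_∈_)
open import Data.List.Membership.Propositional.Properties
  using (∈-++⁺ˡ; ∈-++⁺ʳ; ∈-map⁺; ∈-map⁻; ∈-filter⁺; ∈-filter⁻)
import Data.List.Membership.DecPropositional as DecMembership
open import Data.List.Relation.Unary.All as All using (All; []; _∷_; all?)
open import Data.List.Relation.Unary.All.Properties using (all-filter; map⁺)
open import Data.List.Relation.Unary.Any using (here)
open import Data.List.Relation.Unary.AllPairs using ([]; _∷_)
open import Data.List.Relation.Unary.Unique.Propositional using (Unique)
open import Data.List.Relation.Unary.Unique.Propositional.Properties
  using (filter⁺; cartesianProduct⁺; allFin⁺)
import Data.List.Relation.Unary.Unique.DecPropositional as DecUnique
open import Data.List.Properties using (map-cong; map-id)
open import Data.Nat as ℕ using (ℕ; zero; suc)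
open import Data.Product using (_×_; _,_; proj₁; ∃; uncurry)
open import Data.Product.Properties using (≡-dec)
open import Data.Rational using (ℚ; _/_; _≤_)
open import Data.Sum using (_⊎_; inj₁; inj₂; swap)
open import Data.Vec using ([]; _∷_)
import Data.Vec.Properties as Vec
open import Function using (id)
open import Level using (0ℓ)
open import Relation.Binary using (Rel; Symmetric; Irreflexive; Decidable)
open import Relation.Binary.PropositionalEquality
  using (_≡_; _≢_; refl; sym; trans; subst)
open import Relation.Nullary using (Dec; contradiction)
open import Relation.Nullary.Decidable using (_×-dec_; _⊎-dec_; from-yes; ¬?)

record Graph : Set₁ where
  field
    order      : ℕ
    Adj        : Rel (Fin order) 0ℓ
    adj?       : Decidable Adj
    adj-sym    : Symmetric Adj
    adj-irrefl : Irreflexive _≡_ Adj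

open Graph public

endpoints : ∀ {n} → Fin n × Fin n → Subset n
endpoints (u , v) = ⁅ u ⁆ ∪ ⁅ v ⁆

-- The condition u < v makes each edge occur exactly once.
edgePairs : (G : Graph) → List (Fin (order G) × Fin (order G))
edgePairs G =
  filter (λ (u , v) → (u <? v) ×-dec adj? G u v)
         (cartesianProduct (allFin (order G)) (allFin (order G)))

edges : (G : Graph) → List (Subset (order G))
edges G = map endpoints (edgePairs G)

size : Graph → ℕ
size G = length (edges G)

degree : (G : Graph) → Fin (order G) → ℕ
degree G v = length (filter (adj? G v) (allFin (order G)))

maxDegree : Graph → ℕ
maxDegree G = max 0 (map (degree G) (allFin (order G)))

IdentifyingVertexCover : (G : Graph) → Subset (order G) → Set
IdentifyingVertexCover G T =
  All (λ e → Nonempty (e ∩ T)) (edges G) × Unique (map (_∩ T) (edges G))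

identifyingVertexCover? : (G : Graph) (T : Subset (order G)) →
                          Dec (IdentifyingVertexCover G T)
identifyingVertexCover? G T =
  all? (λ e → nonempty? (e ∩ T)) (edges G)
  ×-dec DecUnique.unique? (Vec.≡-dec _≟ᵇ_) (map (_∩ T) (edges G))

allSubsets : ∀ n → List (Subset n)
allSubsets zero    = [] ∷ []
allSubsets (suc n) = map (outside ∷_) (allSubsets n) ++ map (inside ∷_) (allSubsets n)

-- V(G) is always an identifying vertex cover, so the default value order G of
-- the minimum is harmless; see τD-attained and τD-minimal below.
τD : Graph → ℕ
τD G = min (order G)
           (map ∣_∣ (filter (identifyingVertexCover? G) (allSubsets (order G))))

bound : Graph → ℚ
bound G = (Δ * (Δ - + 1) * + order G + + 2 * + size G) / (1 ℕ.+ maxDegree G ℕ.^ 2)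
  where
  Δ : ℤ
  Δ = + maxDegree G

SatisfiesBound : Graph → Set
SatisfiesBound G = + τD G / 1 ≤ bound G

a b x₁ x₂ c₁ c₂ d₁ d₂ : Fin 8
a  = # 0
b  = # 1
x₁ = # 2
x₂ = # 3
c₁ = # 4
c₂ = # 5
d₁ = # 6
d₂ = # 7

H₂₂-edges : List (Fin 8 × Fin 8)
H₂₂-edges =
  (a , x₁) ∷ (a , x₂) ∷ (b , x₁) ∷ (b , x₂) ∷ (a , c₁) ∷ (a , c₂) ∷
  (c₁ , d₁) ∷ (c₂ , d₂) ∷ (d₁ , b) ∷ (d₂ , b) ∷ (d₁ , d₂) ∷ []

H₂₂-loopless : All (uncurry _≢_) H₂₂-edges
H₂₂-loopless = from-yes (all? (λ (u , v) → ¬? (u ≟ᶠ v)) H₂₂-edges)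

H₂₂ : Graph
H₂₂ = record
  { order      = 8
  ; Adj        = λ u v → (u , v) ∈ H₂₂-edges ⊎ (v , u) ∈ H₂₂-edges
  ; adj?       = λ u v → ((u , v) ∈? H₂₂-edges) ⊎-dec ((v , u) ∈? H₂₂-edges)
  ; adj-sym    = swap
  ; adj-irrefl = λ { refl (inj₁ e) → All.lookup H₂₂-loopless e refl
                   ; refl (inj₂ e) → All.lookup H₂₂-loopless e refl }
  }
  where
  open DecMembership (≡-dec _≟ᶠ_ _≟ᶠ_) using (_∈?_)

∈-allSubsets : ∀ {n} (T : Subset n) → T ∈ allSubsets n
∈-allSubsets []            = here refl
∈-allSubsets (outside ∷ T) = ∈-++⁺ˡ (∈-map⁺ (outside ∷_) (∈-allSubsets T))
∈-allSubsets {suc n} (inside ∷ T) =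
  ∈-++⁺ʳ (map (outside ∷_) (allSubsets n)) (∈-map⁺ (inside ∷_) (∈-allSubsets T))

private
  endpoints⁻ : ∀ {n} {w u v : Fin n} → w ∈ˢ endpoints (u , v) → w ≡ u ⊎ w ≡ v
  endpoints⁻ {u = u} {v} w∈ with x∈p∪q⁻ ⁅ u ⁆ ⁅ v ⁆ w∈
  ... | inj₁ w∈u = inj₁ (x∈⁅y⁆⇒x≡y u w∈u)
  ... | inj₂ w∈v = inj₂ (x∈⁅y⁆⇒x≡y v w∈v)

  endpoints-injective : ∀ {n} {p q : Fin n × Fin n} →
    uncurry _<_ p → uncurry _<_ q → endpoints p ≡ endpoints q → p ≡ q
  endpoints-injective {p = u , v} {u′ , v′} u<v u′<v′ eq
    with endpoints⁻ (subst (u ∈ˢ_) eq (x∈p∪q⁺ (inj₁ (x∈⁅x⁆ u))))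
       | endpoints⁻ (subst (v ∈ˢ_) eq (x∈p∪q⁺ {p = ⁅ u ⁆} (inj₂ (x∈⁅x⁆ v))))
  ... | inj₁ refl | inj₁ refl = contradiction u<v (<-irrefl refl)
  ... | inj₁ refl | inj₂ refl = refl
  ... | inj₂ refl | inj₁ refl = contradiction u<v (<-asym u′<v′)
  ... | inj₂ refl | inj₂ refl = contradiction u<v (<-irrefl refl)

  map-unique : ∀ {A B : Set} {P : A → Set} {f : A → B} →
    (∀ {x y} → P x → P y → f x ≡ f y → x ≡ y) →
    ∀ {xs} → All P xs → Unique xs → Unique (map f xs)
  map-unique inj []         []             = []
  map-unique inj (px ∷ pxs) (x∉xs ∷ xs!) =
    map⁺ (All.zipWith (λ (py , x≢y) fx≡fy → x≢y (inj px py fx≡fy)) (pxs , x∉xs))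
    ∷ map-unique inj pxs xs!

edges-unique : ∀ G → Unique (edges G)
edges-unique G =
  map-unique endpoints-injective
    (All.map proj₁ (all-filter edge? pairs))
    (filter⁺ edge? (cartesianProduct⁺ (allFin⁺ _) (allFin⁺ _)))
  where
  pairs = cartesianProduct (allFin (order G)) (allFin (order G))
  edge? = λ ((u , v) : Fin (order G) × Fin (order G)) → (u <? v) ×-dec adj? G u v

⊤-identifying : ∀ G → IdentifyingVertexCover G ⊤
⊤-identifying G =
  map⁺ (All.universal
    (λ (u , v) → u , subst (u ∈ˢ_) (sym (∩-identityʳ _)) (x∈p∪q⁺ (inj₁ (x∈⁅x⁆ u))))
    (edgePairs G)) ,
  subst Unique (sym (trans (map-cong ∩-identityʳ (edges G)) (map-id (edges G))))
        (edges-unique G)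

τD-attained : ∀ G → ∃ λ T → IdentifyingVertexCover G T × ∣ T ∣ ≡ τD G
τD-attained G with argmin-sel id (order G)
  (map ∣_∣ (filter (identifyingVertexCover? G) (allSubsets (order G))))
... | inj₁ τ≡n = ⊤ , ⊤-identifying G , trans (∣⊤∣≡n (order G)) (sym τ≡n)
... | inj₂ τ∈ with ∈-map⁻ ∣_∣ τ∈
...   | T , T∈ , τ≡ with ∈-filter⁻ (identifyingVertexCover? G) {xs = allSubsets (order G)} T∈
...     | _ , ivc = T , ivc , sym τ≡

τD-minimal : ∀ G T → IdentifyingVertexCover G T → τD G ℕ.≤ ∣ T ∣
τD-minimal G T ivc =
  All.lookup (min≤xs (order G) _)
    (∈-map⁺ ∣_∣ (∈-filter⁺ (identifyingVertexCover? G) (∈-allSubsets T) ivc))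

{-# OPTIONS --safe #-}

-- The complement of an identifying vertex cover is a packing, i.e. a set of
-- vertices at pairwise distance at least 3, and conversely.  With the weight
-- Δ + 1 − d(v) on each vertex, of total W = (Δ + 1) n − 2m, the bound says that
-- some packing S has W ≤ |S| (Δ² + 1).
--
-- Take S maximal among the packings of vertices of degree at most 1.  The ball
-- of radius 2 around such a vertex lies in a closed star, and every closed star
-- has weight at most Δ² + 1; so S suffices if its balls cover the graph.
-- Otherwise an uncovered vertex extends S, and the uncovered vertices have
-- degree at least 2, hence weight at most Δ − 1.  If S is nonempty, comparing
-- with the number of uncovered vertices suffices for n ≤ 7.  If S is empty, all
-- degrees are at least 2: two vertices at distance at least 3 suffice, and
-- in diameter at most 2, counting walks of length 2 gives n (n − 1) ≤ Σ d², which
-- together with (d − 2)(Δ − d) ≥ 0 makes m large enough.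
module Submission where

open import Defs
open import Data.Nat using (_≤_)
open import Data.Product using (_×_)
open import Relation.Binary.PropositionalEquality using (_≡_)
open import Relation.Nullary using (¬_)

import Algebra.Properties.Semiring.Sum
open import Data.Bool using (if_then_else_)
open import Data.Fin as Fin using (Fin; zero; suc)
open import Data.Fin.Properties using (any?; <-cmp) renaming (_≟_ to _≟ᶠ_)
open import Data.Fin.Subset using (Subset; ∣_∣; ⊤; _∩_; _⊆_; Nonempty; ⁅_⁆)
  renaming (_∈_ to _∈ˢ_; _-_ to _∖_)
import Data.Fin.Subset.Properties as Subset
import Data.Integer as ℤ
import Data.Integer.Properties as ℤ
import Data.Integer.Tactic.RingSolver as ℤ
open import Data.List
  using (List; []; _∷_; _++_; map; filter; foldr; length; tabulate; allFin; cartesianProduct)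
open import Data.List.Extrema.Nat using (xs≤max)
import Data.List.Membership.DecPropositional as DecMembership
open import Data.List.Membership.Propositional using (_∈_; _∉_)
open import Data.List.Membership.Propositional.Properties
  using (∈-map⁺; ∈-map⁻; ∈-filter⁻; ∈-allFin)
open import Data.List.Properties using (length-++; length-map; filter-++; map-tabulate)
open import Data.List.Relation.Unary.All as All using (All; []; _∷_)
open import Data.List.Relation.Unary.All.Properties using (¬Any⇒All¬)
open import Data.List.Relation.Unary.AllPairs using (AllPairs; []; _∷_)
import Data.List.Relation.Unary.AllPairs.Properties as AllPairs
open import Data.List.Relation.Unary.Any as Any using (Any; here; there)
open import Data.Nat using (ℕ; zero; suc; _<_; _+_; _*_; _∸_; _^_; z≤n; s≤s)
open import Data.Nat.Properties hiding (_≟_; <-cmp)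
open import Data.Nat.Tactic.RingSolver using (solve-∀)
open import Data.Product using (_,_; ∃; proj₁; proj₂)
import Data.Rational as ℚ
import Data.Rational.Properties as ℚ
import Data.Rational.Unnormalised as ℚᵘ
import Data.Rational.Unnormalised.Properties as ℚᵘ
open import Data.Sum using (_⊎_; inj₁; inj₂)
open import Function using (_∘_; case_of_)
open import Relation.Binary using (Symmetric; Decidable; tri<; tri≈; tri>)
open import Relation.Binary.PropositionalEquality
  using (refl; sym; trans; cong; cong₂; subst; subst₂)
open import Relation.Nullary using (Dec; yes; no; does; contradiction)
open import Relation.Nullary.Decidable
  using (_×-dec_; _⊎-dec_; _→-dec_; ¬?; dec-true; dec-false; decidable-stable; toWitness; from-no)
open import Relation.Unary as Pred using (Pred)

open Algebra.Properties.Semiring.Sum +-*-semiring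
open ≤-Reasoning

-- Indicators and finite sums

𝟙 : {A : Set} → Dec A → ℕ
𝟙 A? = if does A? then 1 else 0

𝟙-yes : {A : Set} (A? : Dec A) → A → 𝟙 A? ≡ 1
𝟙-yes A? p = cong (if_then 1 else 0) (dec-true A? p)

𝟙-no : {A : Set} (A? : Dec A) → ¬ A → 𝟙 A? ≡ 0
𝟙-no A? ¬p = cong (if_then 1 else 0) (dec-false A? ¬p)

𝟙-cong : {A B : Set} (A? : Dec A) (B? : Dec B) → (A → B) → (B → A) → 𝟙 A? ≡ 𝟙 B?
𝟙-cong (yes p) B? f g = sym (𝟙-yes B? (f p))
𝟙-cong (no ¬p) B? f g = sym (𝟙-no B? (¬p ∘ g))

𝟙-≤ : {A : Set} (A? : Dec A) {x : ℕ} → (A → 1 ≤ x) → 𝟙 A? ≤ x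
𝟙-≤ (yes p) f = f p
𝟙-≤ (no _)  f = z≤n

𝟙-*-≤ : {A : Set} (A? : Dec A) {x y : ℕ} → (A → x ≤ y) → 𝟙 A? * x ≤ 𝟙 A? * y
𝟙-*-≤ (yes p) f = +-monoˡ-≤ 0 (f p)
𝟙-*-≤ (no _)  f = z≤n

𝟙-*-idem : {A : Set} (A? : Dec A) → 𝟙 A? * 𝟙 A? ≡ 𝟙 A?
𝟙-*-idem (yes _) = refl
𝟙-*-idem (no _)  = refl

𝟙-disjoint : {A B C : Set} (A? : Dec A) (B? : Dec B) (C? : Dec C) →
  (A → C) → (B → C) → (A → ¬ B) → 𝟙 A? + 𝟙 B? ≤ 𝟙 C?
𝟙-disjoint (yes p) (yes q) C? f g h = contradiction q (h p)
𝟙-disjoint (yes p) (no _)  C? f g h = ≤-reflexive (sym (𝟙-yes C? (f p)))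
𝟙-disjoint (no _)  B?      C? f g h = 𝟙-≤ B? (≤-reflexive ∘ sym ∘ 𝟙-yes C? ∘ g)

∑-mono : ∀ {n} {f g : Fin n → ℕ} → (∀ i → f i ≤ g i) → sum f ≤ sum g
∑-mono {zero}  f≤g = z≤n
∑-mono {suc n} f≤g = +-mono-≤ (f≤g zero) (∑-mono (f≤g ∘ suc))

f≤∑f : ∀ {n} (f : Fin n → ℕ) i → f i ≤ sum f
f≤∑f f zero    = m≤m+n (f zero) _
f≤∑f f (suc i) = ≤-trans (f≤∑f (f ∘ suc) i) (m≤n+m _ (f zero))

∑-const : ∀ n c → ∑[ i < n ] c ≡ n * c
∑-const zero    c = refl
∑-const (suc n) c = cong (c +_) (∑-const n c)

∑-𝟙≟-* : ∀ {n} (i : Fin n) (f : Fin n → ℕ) → ∑[ j < n ] (𝟙 (i ≟ᶠ j) * f j) ≡ f i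
∑-𝟙≟-* {suc n} zero f =
  trans (cong₂ _+_ (*-identityˡ (f zero)) (sum-replicate-zero n)) (+-identityʳ _)
∑-𝟙≟-* (suc i) f = ∑-𝟙≟-* i (f ∘ suc)

∑-𝟙≟ : ∀ {n} (i : Fin n) → ∑[ j < n ] 𝟙 (i ≟ᶠ j) ≡ 1
∑-𝟙≟ i = trans (sum-cong-≗ (λ j → sym (*-identityʳ (𝟙 (i ≟ᶠ j))))) (∑-𝟙≟-* i (λ _ → 1))

length-filter-tabulate : ∀ {A : Set} {P : Pred A _} (P? : Pred.Decidable P) {n} (f : Fin n → A) →
  length (filter P? (tabulate f)) ≡ ∑[ i < n ] 𝟙 (P? (f i))
length-filter-tabulate P? {zero}  f = refl
length-filter-tabulate P? {suc n} f with P? (f zero)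
... | yes _ = cong suc (length-filter-tabulate P? (f ∘ suc))
... | no  _ = length-filter-tabulate P? (f ∘ suc)

length-filter-cartesianProduct : ∀ {A B : Set} {P : Pred (A × B) _} (P? : Pred.Decidable P)
  {k l} (f : Fin k → A) (g : Fin l → B) →
  length (filter P? (cartesianProduct (tabulate f) (tabulate g))) ≡
  ∑[ i < k ] ∑[ j < l ] 𝟙 (P? (f i , g j))
length-filter-cartesianProduct P? {zero}  f g = refl
length-filter-cartesianProduct P? {suc k} f g = begin-equality
  length (filter P? (map (f zero ,_) (tabulate g) ++ rest))
    ≡⟨ cong length (filter-++ P? (map (f zero ,_) (tabulate g)) rest) ⟩
  length (filter P? (map (f zero ,_) (tabulate g)) ++ filter P? rest)
    ≡⟨ length-++ (filter P? (map (f zero ,_) (tabulate g))) ⟩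
  length (filter P? (map (f zero ,_) (tabulate g))) + length (filter P? rest)
    ≡⟨ cong₂ _+_
         (trans (cong (length ∘ filter P?) (map-tabulate g (f zero ,_)))
                (length-filter-tabulate P? (λ j → f zero , g j)))
         (length-filter-cartesianProduct P? (f ∘ suc) g) ⟩
  _ ∎
  where rest = cartesianProduct (tabulate (f ∘ suc)) (tabulate g)

-- Lists, edges as vertex sets, greedy selection

AllPairs-map-All : ∀ {A : Set} {P : A → Set} {Q R : A → A → Set} →
  (∀ {x y} → P x → P y → Q x y → R x y) →
  ∀ {xs} → All P xs → AllPairs Q xs → AllPairs R xs
AllPairs-map-All f []         []         = []
AllPairs-map-All f (px ∷ pxs) (qx ∷ qxs) =
  All.zipWith (λ (py , q) → f px py q) (pxs , qx) ∷ AllPairs-map-All f pxs qxs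

∈-endpoints⁻ : ∀ {n} {w u v : Fin n} → w ∈ˢ endpoints (u , v) → w ≡ u ⊎ w ≡ v
∈-endpoints⁻ {u = u} {v} w∈ with Subset.x∈p∪q⁻ ⁅ u ⁆ ⁅ v ⁆ w∈
... | inj₁ w∈u = inj₁ (Subset.x∈⁅y⁆⇒x≡y u w∈u)
... | inj₂ w∈v = inj₂ (Subset.x∈⁅y⁆⇒x≡y v w∈v)

∈-endpointsˡ : ∀ {n} (u v : Fin n) → u ∈ˢ endpoints (u , v)
∈-endpointsˡ u v = Subset.x∈p∪q⁺ (inj₁ (Subset.x∈⁅x⁆ u))

∈-endpointsʳ : ∀ {n} (u v : Fin n) → v ∈ˢ endpoints (u , v)
∈-endpointsʳ u v = Subset.x∈p∪q⁺ {p = ⁅ u ⁆} (inj₂ (Subset.x∈⁅x⁆ v))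

removeAll : ∀ {n} → List (Fin n) → Subset n
removeAll = foldr (λ s p → p ∖ s) ⊤

∉⇒∈-removeAll : ∀ {n} {v : Fin n} S → v ∉ S → v ∈ˢ removeAll S
∉⇒∈-removeAll []      v∉S = Subset.∈⊤
∉⇒∈-removeAll (s ∷ S) v∉S =
  Subset.x∈p∧x≢y⇒x∈p-y (∉⇒∈-removeAll S (v∉S ∘ there)) (v∉S ∘ here)

-- An element satisfying `P` is kept unless it is related to one kept before. Reflexivity lets a
-- kept element cover itself; symmetry is used because `miss` speaks of `R s x` while the new list
-- needs the pair in the order `x`, `s`.
greedy : ∀ {A : Set} {R : A → A → Set} {P : A → Set} →
  (∀ {x} → R x x) → Symmetric R → Decidable R → Pred.Decidable P → ∀ xs →
  ∃ λ S → AllPairs (λ s t → ¬ R s t) S × All P S ×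
          (∀ {x} → x ∈ xs → P x → Any (λ s → R s x) S)
greedy R-refl R-sym R? P? [] = [] , [] , [] , λ ()
greedy {R = R} R-refl R-sym R? P? (x ∷ xs)
  with S , S! , PS , cov ← greedy R-refl R-sym R? P? xs | P? x | Any.any? (λ s → R? s x) S
... | no ¬Px | _ = S , S! , PS ,
  λ { (here refl) Px → contradiction Px ¬Px ; (there x∈) → cov x∈ }
... | yes _ | yes hit = S , S! , PS ,
  λ { (here refl) _ → hit ; (there x∈) → cov x∈ }
... | yes Px | no miss = x ∷ S , All.map (_∘ R-sym) (¬Any⇒All¬ S miss) ∷ S! , Px ∷ PS ,
  λ { (here refl) _ → here R-refl ; (there x∈) → there ∘ cov x∈ }

-- Numerical inequalities

k≤k*k : ∀ k → k ≤ k * k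
k≤k*k zero    = z≤n
k≤k*k (suc k) = m≤m+n (suc k) (k * suc k)

-- Here `c` is the degree of the centre of a star and `w` its weight, and each of the `c` leaves
-- weighs at most `Δ`. With `Δ = c + k` the slack is `c * k + (k * k - k)`.
star-arith : ∀ {w c Δ} → w + c ≡ suc Δ → c ≤ Δ → w + c * Δ ≤ suc (Δ * Δ)
star-arith {w} {c} {Δ} w+c≡ c≤Δ with k , refl ← m≤n⇒∃[o]m+o≡n c≤Δ = begin
  w + c * (c + k)                          ≡⟨ cong (_+ c * (c + k)) w≡ ⟩
  suc k + c * (c + k)                      ≤⟨ +-monoˡ-≤ _ (s≤s (k≤k*k k)) ⟩
  suc (k * k) + c * (c + k)                ≤⟨ m≤m+n _ (c * k) ⟩
  suc (k * k) + c * (c + k) + c * k        ≡⟨ expand c k ⟩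
  suc ((c + k) * (c + k))                  ∎
  where
  w≡ : w ≡ suc k
  w≡ = +-cancelʳ-≡ c w (suc k) (trans w+c≡ (cong suc (+-comm c k)))

  expand : ∀ c k → suc (k * k) + c * (c + k) + c * k ≡ suc ((c + k) * (c + k))
  expand = solve-∀

-- (c − 2)(Δ − c) ≥ 0, without subtraction.
convexity : ∀ {c Δ} → 2 ≤ c → c ≤ Δ → c * c + 2 * Δ ≤ (Δ + 2) * c
convexity 2≤c c≤Δ with i , refl ← m≤n⇒∃[o]m+o≡n 2≤c | j , refl ← m≤n⇒∃[o]m+o≡n c≤Δ =
  ≤-trans (m≤m+n _ (i * j)) (≤-reflexive (expand i j))
  where
  expand : ∀ i j → (2 + i) * (2 + i) + 2 * (2 + i + j) + i * j ≡ (2 + i + j + 2) * (2 + i)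
  expand = solve-∀

-- One further packing vertex pays for up to five uncovered vertices. For `u = 5` and `Δ = 2 + k`
-- the slack is `k * k - k`, so equality occurs at `Δ = 2` and `Δ = 3`.
few-uncovered : ∀ {Δ u} → 2 ≤ Δ → u ≤ 5 → u * (Δ ∸ 1) ≤ suc (Δ * Δ)
few-uncovered {suc (suc k)} {u} (s≤s (s≤s _)) u≤5 = begin
  u * suc k                  ≤⟨ *-monoˡ-≤ (suc k) u≤5 ⟩
  5 * suc k                  ≡⟨ lhs k ⟩
  5 + 4 * k + k              ≤⟨ +-monoʳ-≤ (5 + 4 * k) (k≤k*k k) ⟩
  5 + 4 * k + k * k          ≡⟨ rhs k ⟩
  suc ((2 + k) * (2 + k))    ∎
  where
  lhs : ∀ k → 5 * suc k ≡ 5 + 4 * k + k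
  lhs = solve-∀

  rhs : ∀ k → 5 + 4 * k + k * k ≡ suc ((2 + k) * (2 + k))
  rhs = solve-∀

-- Six edges bring `W = n (Δ + 1) - 2m` down to at most `7 (Δ + 1) - 12`, and two packing vertices
-- pay for that.
many-uncovered : ∀ {W m n Δ} → W + 2 * m ≡ n * suc Δ → n ≤ 7 → 6 ≤ m → 2 ≤ Δ →
  W ≤ 2 * suc (Δ * Δ)
many-uncovered {W} {m} {n} {Δ@(suc (suc k))} W≡ n≤7 6≤m (s≤s (s≤s _)) = +-cancelʳ-≤ 12 _ _ (begin
  W + 12                               ≤⟨ +-monoʳ-≤ W (*-monoʳ-≤ 2 6≤m) ⟩
  W + 2 * m                            ≡⟨ W≡ ⟩
  n * suc Δ                            ≤⟨ *-monoˡ-≤ (suc Δ) n≤7 ⟩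
  7 * suc Δ                            ≤⟨ m≤m+n _ (1 + k + 2 * (k * k)) ⟩
  7 * suc Δ + (1 + k + 2 * (k * k))    ≡⟨ expand k ⟩
  2 * suc (Δ * Δ) + 12                 ∎)
  where
  expand : ∀ k → 7 * suc (2 + k) + (1 + k + 2 * (k * k)) ≡ 2 * suc ((2 + k) * (2 + k)) + 12
  expand = solve-∀

two-balls : ∀ {n Δ} → n ≤ 7 → 2 ≤ Δ → n * (Δ ∸ 1) ≤ 2 * suc (Δ * Δ)
two-balls {n} {suc (suc k)} n≤7 (s≤s (s≤s _)) = begin
  n * suc k                          ≤⟨ *-monoˡ-≤ (suc k) n≤7 ⟩
  7 * suc k                          ≤⟨ m≤m+n _ (3 + k + 2 * (k * k)) ⟩
  7 * suc k + (3 + k + 2 * (k * k))  ≡⟨ expand k ⟩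
  2 * suc ((2 + k) * (2 + k))        ∎
  where
  expand : ∀ k → 7 * suc k + (3 + k + 2 * (k * k)) ≡ 2 * suc ((2 + k) * (2 + k))
  expand = solve-∀

-- For `n = 7` this fails at `Δ = 2, ..., 5`; those values require the count of walks.
one-ball-large : ∀ {n Δ} → n ≤ 7 → 6 ≤ Δ → n * (Δ ∸ 1) ≤ suc (Δ * Δ)
one-ball-large {n} n≤7 6≤Δ with k , refl ← m≤n⇒∃[o]m+o≡n 6≤Δ = begin
  n * (5 + k)                        ≤⟨ *-monoˡ-≤ (5 + k) n≤7 ⟩
  7 * (5 + k)                        ≤⟨ m≤m+n _ (2 + 5 * k + k * k) ⟩
  7 * (5 + k) + (2 + 5 * k + k * k)  ≡⟨ expand k ⟩
  suc ((6 + k) * (6 + k))            ∎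
  where
  expand : ∀ k → 7 * (5 + k) + (2 + 5 * k + k * k) ≡ suc ((6 + k) * (6 + k))
  expand = solve-∀

-- The walk inequality forces `m` to be large. With `n` and `Δ` bounded, finitely many triples
-- remain, and they are checked by evaluation.
one-ball-small : ∀ {n Δ m} → n ≤ 7 → Δ ≤ 5 →
  n * n + n * (2 * Δ) ≤ n + (Δ + 2) * (2 * m) → n * suc Δ ≤ suc (Δ * Δ) + 2 * m
one-ball-small {n} {Δ} {m} n≤7 Δ≤5 walks with m <? 21
-- The cutoff 21 is half of `42 = 7 * 6`, the largest possible value of `n * suc Δ`, so `2 * m`
-- alone suffices here.
... | no m≮21 = begin
  n * suc Δ            ≤⟨ *-mono-≤ n≤7 (s≤s Δ≤5) ⟩
  42                   ≤⟨ *-monoʳ-≤ 2 (≮⇒≥ m≮21) ⟩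
  2 * m                ≤⟨ m≤n+m _ (suc (Δ * Δ)) ⟩
  suc (Δ * Δ) + 2 * m  ∎
... | yes m<21 = table (s≤s n≤7) (s≤s Δ≤5) m<21 walks
  where
  Check : ℕ → ℕ → ℕ → Set
  Check n Δ m = n * n + n * (2 * Δ) ≤ n + (Δ + 2) * (2 * m) → n * suc Δ ≤ suc (Δ * Δ) + 2 * m

  check? : ∀ n Δ m → Dec (Check n Δ m)
  check? n Δ m = (n * n + n * (2 * Δ) ≤? n + (Δ + 2) * (2 * m)) →-dec (n * suc Δ ≤? suc (Δ * Δ) + 2 * m)

  table : ∀ {n} → n < 8 → ∀ {Δ} → Δ < 6 → ∀ {m} → m < 21 → Check n Δ m
  table = toWitness {a? = allUpTo? (λ n → allUpTo? (λ Δ → allUpTo? (check? n Δ) 21) 6) 8} _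

one-ball : ∀ {W n Δ m} → n ≤ 7 → W + 2 * m ≡ n * suc Δ → W ≤ n * (Δ ∸ 1) →
  n * n + n * (2 * Δ) ≤ n + (Δ + 2) * (2 * m) → W ≤ suc (Δ * Δ)
one-ball {W} {n} {Δ} {m} n≤7 W≡ W≤ walks with Δ ≤? 5
... | yes Δ≤5 = +-cancelʳ-≤ (2 * m) _ _
  (≤-trans (≤-reflexive W≡) (one-ball-small {m = m} n≤7 Δ≤5 walks))
... | no  Δ≰5 = ≤-trans W≤ (one-ball-large n≤7 (≰⇒> Δ≰5))

-- A packing of `suc p` low-degree vertices leaves `u` vertices uncovered. If `u ≤ 5`, the added
-- vertex pays for all of them; otherwise `m ≥ 6`, and two packing vertices already pay for the
-- whole graph.
one-more-ball : ∀ {W n Δ m u} p → n ≤ 7 → 2 ≤ Δ → W + 2 * m ≡ n * suc Δ → u ≤ m →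
  W ≤ suc p * suc (Δ * Δ) + u * (Δ ∸ 1) → W ≤ (2 + p) * suc (Δ * Δ)
one-more-ball {W} {n} {Δ} {m} {u} p n≤7 2≤Δ W≡ u≤m W≤ with u ≤? 5
... | yes u≤5 = begin
  W                                      ≤⟨ W≤ ⟩
  suc p * suc (Δ * Δ) + u * (Δ ∸ 1)      ≤⟨ +-monoʳ-≤ (suc p * suc (Δ * Δ)) (few-uncovered 2≤Δ u≤5) ⟩
  suc p * suc (Δ * Δ) + suc (Δ * Δ)      ≡⟨ +-comm (suc p * suc (Δ * Δ)) _ ⟩
  (2 + p) * suc (Δ * Δ)                  ∎
... | no u≰5 = begin
  W                                      ≤⟨ many-uncovered {W} {m} {n} W≡ n≤7 (≤-trans (≰⇒> u≰5) u≤m) 2≤Δ ⟩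
  2 * suc (Δ * Δ)                        ≤⟨ *-monoˡ-≤ (suc (Δ * Δ)) (m≤m+n 2 p) ⟩
  (2 + p) * suc (Δ * Δ)                  ∎

-- Degrees and the handshake identity

module _ (G : Graph) where

  private
    n = order G
    Δ = maxDegree G
    d = degree G
    m = size G

  e : Fin n → Fin n → ℕ
  e u v = 𝟙 (adj? G u v)

  e-sym : ∀ u v → e u v ≡ e v u
  e-sym u v = 𝟙-cong (adj? G u v) (adj? G v u) (adj-sym G) (adj-sym G)

  degree≡∑ : ∀ v → d v ≡ ∑[ u < n ] e v u
  degree≡∑ v = length-filter-tabulate (adj? G v) (λ u → u)

  degree≤Δ : ∀ v → d v ≤ Δ
  degree≤Δ v = All.lookup (xs≤max 0 (map d (allFin n))) (∈-map⁺ d (∈-allFin v))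

  -- `edgePairs` keeps only the increasing orientation of an edge, counted by `h`. Thus `e u v`
  -- splits as `h u v + h v u`, and exchanging the sums shows that both halves equal `m`.
  handshake : ∑[ v < n ] d v ≡ 2 * m
  handshake = begin-equality
    ∑[ v < n ] d v                                       ≡⟨ sum-cong-≗ degree≡∑ ⟩
    ∑[ u < n ] ∑[ v < n ] e u v                          ≡⟨ sum-cong-≗ (λ u → sum-cong-≗ (split u)) ⟩
    ∑[ u < n ] ∑[ v < n ] (h u v + h v u)                ≡⟨ sum-cong-≗ (λ u → ∑-distrib-+ (h u) (λ v → h v u)) ⟩
    ∑[ u < n ] (∑[ v < n ] h u v + ∑[ v < n ] h v u)     ≡⟨ ∑-distrib-+ (λ u → ∑[ v < n ] h u v) _ ⟩
    ∑∑h + ∑[ u < n ] ∑[ v < n ] h v u                    ≡⟨ cong (∑∑h +_) (∑-comm (λ u v → h v u)) ⟩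
    ∑∑h + ∑∑h                                            ≡⟨ cong₂ _+_ size≡ size≡ ⟨
    m + m                                                ≡⟨ cong (m +_) (+-identityʳ m) ⟨
    2 * m                                                ∎
    where
    edge? : ∀ u v → Dec (u Fin.< v × Adj G u v)
    edge? u v = (u Fin.<? v) ×-dec adj? G u v

    h : Fin n → Fin n → ℕ
    h u v = 𝟙 (edge? u v)

    ∑∑h = ∑[ u < n ] ∑[ v < n ] h u v

    size≡ : m ≡ ∑∑h
    size≡ = trans (length-map endpoints (edgePairs G))
                  (length-filter-cartesianProduct (λ (u , v) → edge? u v) (λ u → u) (λ v → v))

    split : ∀ u v → e u v ≡ h u v + h v u
    split u v with <-cmp u v
    ... | tri< u<v _ v≮u = sym (trans
      (cong₂ _+_ (𝟙-cong (edge? u v) (adj? G u v) proj₂ (u<v ,_)) (𝟙-no (edge? v u) (v≮u ∘ proj₁)))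
      (+-identityʳ _))
    ... | tri> u≮v _ v<u = sym
      (cong₂ _+_ (𝟙-no (edge? u v) (u≮v ∘ proj₁))
                 (𝟙-cong (edge? v u) (adj? G u v) (adj-sym G ∘ proj₂) (λ uv → v<u , adj-sym G uv)))
    ... | tri≈ u≮v u≡v v≮u = trans (𝟙-no (adj? G u v) (adj-irrefl G u≡v)) (sym
      (cong₂ _+_ (𝟙-no (edge? u v) (u≮v ∘ proj₁)) (𝟙-no (edge? v u) (v≮u ∘ proj₁))))

  -- Packings and identifying vertex covers

  -- Distance at most 2, so that a `Packing` has pairwise distances at least 3.
  Close : Fin n → Fin n → Set
  Close s t = s ≡ t ⊎ Adj G s t ⊎ ∃ λ u → Adj G s u × Adj G u t

  close? : Decidable Close
  close? s t = (s ≟ᶠ t) ⊎-dec (adj? G s t ⊎-dec any? (λ u → adj? G s u ×-dec adj? G u t))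

  close-sym : Symmetric Close
  close-sym (inj₁ s≡t)                  = inj₁ (sym s≡t)
  close-sym (inj₂ (inj₁ st))            = inj₂ (inj₁ (adj-sym G st))
  close-sym (inj₂ (inj₂ (u , su , ut))) = inj₂ (inj₂ (u , adj-sym G ut , adj-sym G su))

  Packing : List (Fin n) → Set
  Packing = AllPairs (λ s t → ¬ Close s t)

  packing-≡ : ∀ {S x y} → Packing S → x ∈ S → y ∈ S → Close x y → x ≡ y
  packing-≡ (s≁ ∷ S!) (here refl) (here refl) x~y = refl
  packing-≡ (s≁ ∷ S!) (here refl) (there y∈)  x~y = contradiction x~y (All.lookup s≁ y∈)
  packing-≡ (s≁ ∷ S!) (there x∈)  (here refl) x~y = contradiction (close-sym x~y) (All.lookup s≁ x∈)
  packing-≡ (s≁ ∷ S!) (there x∈)  (there y∈)  x~y = packing-≡ S! x∈ y∈ x~y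

  packing-independent : ∀ {S x y} → Packing S → Adj G x y → x ∈ S → y ∉ S
  packing-independent S! xy x∈S y∈S = adj-irrefl G (packing-≡ S! x∈S y∈S (inj₂ (inj₁ xy))) xy

  -- `Close` is reflexive, so the entries of a packing are distinct and each deletion removes a
  -- vertex that is still present.
  ∣removeAll∣ : ∀ {S} → Packing S → ∣ removeAll S ∣ + length S ≤ n
  ∣removeAll∣ []                   = ≤-reflexive (trans (+-identityʳ _) (Subset.∣⊤∣≡n n))
  ∣removeAll∣ {s ∷ S} (s≁ ∷ S!) = begin
    ∣ removeAll S ∖ s ∣ + suc (length S)  ≡⟨ +-suc _ (length S) ⟩
    suc ∣ removeAll S ∖ s ∣ + length S    ≤⟨ +-monoˡ-≤ (length S) (Subset.x∈p⇒∣p-x∣<∣p∣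
                                               (∉⇒∈-removeAll S λ s∈S → All.lookup s≁ s∈S (inj₁ refl))) ⟩
    ∣ removeAll S ∣ + length S            ≤⟨ ∣removeAll∣ S! ⟩
    n                                     ∎

  -- The order condition `u < v` is dropped, so that either end can be named first, as `other-end`
  -- does.
  IsEdge : Subset n → Set
  IsEdge f = ∃ λ u → ∃ λ v → Adj G u v × f ≡ endpoints (u , v)

  edges-isEdge : All IsEdge (edges G)
  edges-isEdge = All.tabulate λ f∈ →
    let (u , v) , uv∈ , f≡ = ∈-map⁻ endpoints f∈
        uv = proj₂ (proj₂ (∈-filter⁻ (λ (u , v) → (u Fin.<? v) ×-dec adj? G u v)
                                     {xs = cartesianProduct (allFin n) (allFin n)} uv∈))
    in u , v , uv , f≡

  other-end : ∀ {f x} → IsEdge f → x ∈ˢ f → ∃ λ y → Adj G x y × f ≡ endpoints (x , y)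
  other-end (u , v , uv , refl) x∈f with ∈-endpoints⁻ x∈f
  ... | inj₁ refl = v , uv , refl
  ... | inj₂ refl = u , adj-sym G uv , Subset.∪-comm ⁅ u ⁆ ⁅ v ⁆

  module _ {S} (S! : Packing S) where

    private
      T = removeAll S

      open DecMembership (_≟ᶠ_ {n}) using (_∈?_)

      ∉T⇒∈S : ∀ {v} → ¬ v ∈ˢ T → v ∈ S
      ∉T⇒∈S {v} v∉T with v ∈? S
      ... | yes v∈S = v∈S
      ... | no  v∉S = contradiction (∉⇒∈-removeAll S v∉S) v∉T

    -- Only an end `x` of `f` outside `T` is at issue. It lies in `S`, so its neighbour `y` along
    -- `f` lies in `T`, hence in the common trace and in `g`. It remains to see that the other end
    -- `z` of `g` is `x`.
    trace-⊆ : ∀ {f g} → IsEdge f → IsEdge g → f ∩ T ≡ g ∩ T → f ⊆ g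
    trace-⊆ {f} {g} fe ge eq {x} x∈f with x Subset.∈? T
    ... | yes x∈T = proj₁ (Subset.x∈p∩q⁻ g T (subst (x ∈ˢ_) eq (Subset.x∈p∩q⁺ (x∈f , x∈T))))
    ... | no  x∉T with other-end fe x∈f
    ...   | y , xy , refl with other-end ge y∈g
      where
      y∈T = ∉⇒∈-removeAll S (packing-independent S! xy (∉T⇒∈S x∉T))
      y∈g = proj₁ (Subset.x∈p∩q⁻ g T (subst (y ∈ˢ_) eq (Subset.x∈p∩q⁺ (∈-endpointsʳ x y , y∈T))))
    ...     | z , yz , refl with z Subset.∈? T
    -- Both `x` and `z` lie in `S` and have the common neighbour `y`, so the packing property
    -- identifies them.
    ...       | no  z∉T = subst (_∈ˢ g) z≡x (∈-endpointsʳ y z)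
      where z≡x = sym (packing-≡ S! (∉T⇒∈S x∉T) (∉T⇒∈S z∉T) (inj₂ (inj₂ (y , xy , yz))))
    -- Now `z` belongs to the trace, hence to `f`; but it is neither `x`, which is outside `T`, nor
    -- its own neighbour `y`.
    ...       | yes z∈T with ∈-endpoints⁻ (proj₁ (Subset.x∈p∩q⁻ f T
                (subst (z ∈ˢ_) (sym eq) (Subset.x∈p∩q⁺ (∈-endpointsʳ y z , z∈T)))))
    ...         | inj₁ refl = contradiction z∈T x∉T
    ...         | inj₂ z≡y  = contradiction yz (adj-irrefl G (sym z≡y))

    edge-meets-T : ∀ {f} → IsEdge f → Nonempty (f ∩ T)
    edge-meets-T (u , v , uv , refl) with u Subset.∈? T
    ... | yes u∈T = u , Subset.x∈p∩q⁺ (∈-endpointsˡ u v , u∈T)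
    ... | no  u∉T = v , Subset.x∈p∩q⁺
      (∈-endpointsʳ u v , ∉⇒∈-removeAll S (packing-independent S! uv (∉T⇒∈S u∉T)))

    removeAll-identifying : IdentifyingVertexCover G T
    removeAll-identifying =
      All.map edge-meets-T edges-isEdge ,
      AllPairs.map⁺ (AllPairs-map-All
        (λ fe ge f≢g eq → f≢g (Subset.⊆-antisym (trace-⊆ fe ge eq) (trace-⊆ ge fe (sym eq))))
        edges-isEdge (edges-unique G))

    τD+packing≤order : τD G + length S ≤ n
    τD+packing≤order =
      ≤-trans (+-monoˡ-≤ (length S) (τD-minimal G T removeAll-identifying)) (∣removeAll∣ S!)

  -- Reduction of the bound to weights

  -- The denominator is cleared and the negative term of `Δ (Δ - 1) n` moved to the left, so that
  -- the rest of the argument stays in the natural numbers.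
  satisfiesBound : τD G * suc (Δ * Δ) + Δ * n ≤ Δ * Δ * n + 2 * m → SatisfiesBound G
  satisfiesBound τ≤ = ℚ.toℚᵘ-cancel-≤
    (ℚᵘ.≤-respˡ-≃ (ℚᵘ.≃-sym (ℚ.toℚᵘ-fromℚᵘ lhs))
    (ℚᵘ.≤-respʳ-≃ (ℚᵘ.≃-sym (ℚ.toℚᵘ-fromℚᵘ rhs))
    (ℚᵘ.*≤* (ℤ.0≤i-j⇒j≤i
      (subst (ℤ.0ℤ ℤ.≤_) (cancel (ℤ.+ τD G ℤ.* ℤ.+ suc (Δ ^ 2)) (numerator ℤ.* ℤ.+ 1) (ℤ.+ Δ ℤ.* ℤ.+ n))
        (ℤ.i≤j⇒0≤j-i (subst₂ ℤ._≤_ (sym lhs≡) (sym rhs≡) (ℤ.+≤+ τ≤))))))))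
    where
    numerator = ℤ.+ Δ ℤ.* (ℤ.+ Δ ℤ.- ℤ.+ 1) ℤ.* ℤ.+ n ℤ.+ ℤ.+ 2 ℤ.* ℤ.+ m
    -- The second argument of `mkℚᵘ` is the denominator minus one.
    lhs = ℚᵘ.mkℚᵘ (ℤ.+ τD G) 0
    rhs = ℚᵘ.mkℚᵘ numerator (Δ ^ 2)

    lhs≡ : ℤ.+ τD G ℤ.* ℤ.+ suc (Δ ^ 2) ℤ.+ ℤ.+ Δ ℤ.* ℤ.+ n ≡
           ℤ.+ (τD G * suc (Δ * Δ) + Δ * n)
    lhs≡ = trans
      (cong (λ k → ℤ.+ τD G ℤ.* ℤ.+ suc (Δ * k) ℤ.+ ℤ.+ Δ ℤ.* ℤ.+ n) (*-identityʳ Δ))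
      (trans (cong₂ ℤ._+_ (sym (ℤ.pos-* (τD G) (suc (Δ * Δ)))) (sym (ℤ.pos-* Δ n)))
             (sym (ℤ.pos-+ (τD G * suc (Δ * Δ)) (Δ * n))))

    cancel : ∀ x y z → (y ℤ.+ z) ℤ.- (x ℤ.+ z) ≡ y ℤ.- x
    cancel = ℤ.solve-∀

    expand : ∀ x y z → (x ℤ.* (x ℤ.- ℤ.+ 1) ℤ.* y ℤ.+ z) ℤ.* ℤ.+ 1 ℤ.+ x ℤ.* y ≡ x ℤ.* x ℤ.* y ℤ.+ z
    expand = ℤ.solve-∀

    rhs≡ : numerator ℤ.* ℤ.+ 1 ℤ.+ ℤ.+ Δ ℤ.* ℤ.+ n ≡ ℤ.+ (Δ * Δ * n + 2 * m)
    rhs≡ = trans (expand (ℤ.+ Δ) (ℤ.+ n) (ℤ.+ 2 ℤ.* ℤ.+ m))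
      (trans (cong₂ ℤ._+_
               (trans (cong (ℤ._* ℤ.+ n) (sym (ℤ.pos-* Δ Δ))) (sym (ℤ.pos-* (Δ * Δ) n)))
               (sym (ℤ.pos-* 2 m)))
             (sym (ℤ.pos-+ (Δ * Δ * n) (2 * m))))

  K : ℕ
  K = suc (Δ * Δ)

  weight : Fin n → ℕ
  weight v = suc Δ ∸ d v

  weight+degree : ∀ v → weight v + d v ≡ suc Δ
  weight+degree v = m∸n+n≡m (m≤n⇒m≤1+n (degree≤Δ v))

  ∑weight : ∑[ v < n ] weight v + 2 * m ≡ n * suc Δ
  ∑weight = begin-equality
    sum weight + 2 * m               ≡⟨ cong (sum weight +_) handshake ⟨
    sum weight + sum d               ≡⟨ ∑-distrib-+ weight d ⟨
    ∑[ v < n ] (weight v + d v)      ≡⟨ sum-cong-≗ weight+degree ⟩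
    ∑[ v < n ] suc Δ                 ≡⟨ ∑-const n (suc Δ) ⟩
    n * suc Δ                        ∎

  -- Since `τD G ≤ n - |S|`, the product `τD G * K` is at most `n * K - |S| * K`, hence at most
  -- `n * K - W`, where `W = n (Δ + 1) - 2m` by `∑weight`.
  packing⇒satisfiesBound : ∀ {S} → Packing S → sum weight ≤ length S * K → SatisfiesBound G
  packing⇒satisfiesBound {S} S! W≤ = satisfiesBound (+-cancelʳ-≤ n _ _ (begin
    τD G * K + Δ * n + n                  ≡⟨ lhs (τD G * K) Δ n ⟩
    τD G * K + n * suc Δ                  ≡⟨ cong (τD G * K +_) ∑weight ⟨
    τD G * K + (sum weight + 2 * m)       ≤⟨ +-monoʳ-≤ (τD G * K) (+-monoˡ-≤ (2 * m) W≤) ⟩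
    τD G * K + (length S * K + 2 * m)     ≡⟨ factor (τD G) (length S) K (2 * m) ⟩
    (τD G + length S) * K + 2 * m         ≤⟨ +-monoˡ-≤ (2 * m) (*-monoˡ-≤ K (τD+packing≤order S!)) ⟩
    n * K + 2 * m                         ≡⟨ rhs n Δ (2 * m) ⟩
    Δ * Δ * n + 2 * m + n                 ∎))
    where
    lhs : ∀ x Δ n → x + Δ * n + n ≡ x + n * suc Δ
    lhs = solve-∀

    factor : ∀ t r K x → t * K + (r * K + x) ≡ (t + r) * K + x
    factor = solve-∀

    rhs : ∀ n Δ x → n * suc (Δ * Δ) + x ≡ Δ * Δ * n + x + n
    rhs = solve-∀

  -- Stars and balls of radius two

  adj⇒1≤e : ∀ {u v} → Adj G u v → 1 ≤ e u v
  adj⇒1≤e {u} {v} uv = ≤-reflexive (sym (𝟙-yes (adj? G u v) uv))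

  adj⇒1≤degree : ∀ {u v} → Adj G u v → 1 ≤ d u
  adj⇒1≤degree {u} {v} uv =
    ≤-trans (adj⇒1≤e uv) (≤-trans (f≤∑f (e u) v) (≤-reflexive (sym (degree≡∑ u))))

  two-neighbours : ∀ {s u v} → Adj G s u → Adj G s v → ¬ u ≡ v → 2 ≤ d s
  two-neighbours {s} {u} {v} su sv u≢v = begin
    2                                              ≡⟨ cong₂ _+_ (∑-𝟙≟ u) (∑-𝟙≟ v) ⟨
    sum (λ x → 𝟙 (u ≟ᶠ x)) + sum (λ x → 𝟙 (v ≟ᶠ x)) ≡⟨ ∑-distrib-+ (λ x → 𝟙 (u ≟ᶠ x)) _ ⟨
    ∑[ x < n ] (𝟙 (u ≟ᶠ x) + 𝟙 (v ≟ᶠ x))           ≤⟨ ∑-mono (λ x → 𝟙-disjoint (u ≟ᶠ x) (v ≟ᶠ x) (adj? G s x)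
                                                        (λ { refl → su }) (λ { refl → sv })
                                                        (λ { refl v≡u → u≢v (sym v≡u) })) ⟩
    sum (e s)                                      ≡⟨ degree≡∑ s ⟨
    d s                                            ∎

  star : Fin n → Fin n → ℕ
  star c v = 𝟙 (c ≟ᶠ v) + e c v

  -- Every leaf is adjacent to `c`, so it has degree at least 1 and weight at most `Δ`; `star-arith`
  -- then adds the weight of the centre.
  star-weight : ∀ c → ∑[ v < n ] (star c v * weight v) ≤ K
  star-weight c = begin
    ∑[ v < n ] (star c v * weight v)
      ≡⟨ sum-cong-≗ (λ v → *-distribʳ-+ (weight v) (𝟙 (c ≟ᶠ v)) (e c v)) ⟩
    ∑[ v < n ] (𝟙 (c ≟ᶠ v) * weight v + e c v * weight v)
      ≡⟨ ∑-distrib-+ (λ v → 𝟙 (c ≟ᶠ v) * weight v) _ ⟩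
    ∑[ v < n ] (𝟙 (c ≟ᶠ v) * weight v) + ∑[ v < n ] (e c v * weight v)
      ≤⟨ +-mono-≤ (≤-reflexive (∑-𝟙≟-* c weight)) (∑-mono λ v →
           𝟙-*-≤ (adj? G c v) (λ cv → ∸-monoʳ-≤ (suc Δ) (adj⇒1≤degree (adj-sym G cv)))) ⟩
    weight c + ∑[ v < n ] (e c v * Δ)
      ≡⟨ cong (weight c +_) (*-distribʳ-sum Δ (e c)) ⟨
    weight c + sum (e c) * Δ
      ≡⟨ cong (λ k → weight c + k * Δ) (degree≡∑ c) ⟨
    weight c + d c * Δ
      ≤⟨ star-arith (weight+degree c) (degree≤Δ c) ⟩
    K ∎

  star-centre : ∀ {c v} → c ≡ v → 1 ≤ star c v
  star-centre {c} {v} c≡v = ≤-trans (≤-reflexive (sym (𝟙-yes (c ≟ᶠ v) c≡v))) (m≤m+n _ (e c v))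

  star-leaf : ∀ {c v} → Adj G c v → 1 ≤ star c v
  star-leaf {c} {v} cv = ≤-trans (adj⇒1≤e cv) (m≤n+m _ (𝟙 (c ≟ᶠ v)))

  -- An isolated `s` is its whole ball. Otherwise the star is centred at the unique neighbour of
  -- `s`, through which every walk leaving `s` must pass.
  ball⊆star : ∀ s → d s ≤ 1 → ∃ λ c → ∀ {v} → Close s v → 1 ≤ star c v
  ball⊆star s d≤1 with any? (adj? G s)
  ... | no isolated = s , λ
    { (inj₁ s≡v)                → star-centre s≡v
    ; (inj₂ (inj₁ sv))          → contradiction (_ , sv) isolated
    ; (inj₂ (inj₂ (_ , su , _))) → contradiction (_ , su) isolated
    }
  ... | yes (c , sc) = c , λ
    { (inj₁ refl)                 → star-leaf (adj-sym G sc)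
    ; (inj₂ (inj₁ sv))            → star-centre (unique sv)
    ; (inj₂ (inj₂ (u , su , uv))) → star-leaf (subst (λ u → Adj G u _) (sym (unique su)) uv)
    }
    where
    unique : ∀ {v} → Adj G s v → c ≡ v
    unique {v} sv = decidable-stable (c ≟ᶠ v) λ c≢v →
      contradiction (two-neighbours sc sv c≢v) (≤⇒≯ d≤1)

  -- The function `g` makes the induction go through: dropping the head of `S` moves the weight of
  -- its star, at most `K` in total, into `g`.
  cover : ∀ {S} → All (λ s → d s ≤ 1) S → (g : Fin n → ℕ) →
    (∀ v → Any (λ s → Close s v) S ⊎ weight v ≤ g v) →
    sum weight ≤ length S * K + sum g
  cover []  g cov = ∑-mono λ v → case cov v of λ { (inj₂ w≤g) → w≤g }
  cover {s ∷ S} (d≤1 ∷ low) g cov with c , hit ← ball⊆star s d≤1 = begin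
    sum weight                                                 ≤⟨ cover low (λ v → starred v + g v) cov′ ⟩
    length S * K + ∑[ v < n ] (starred v + g v)                ≡⟨ cong (length S * K +_) (∑-distrib-+ starred g) ⟩
    length S * K + (sum starred + sum g)                       ≤⟨ +-monoʳ-≤ (length S * K) (+-monoˡ-≤ (sum g) (star-weight c)) ⟩
    length S * K + (K + sum g)                                 ≡⟨ regroup (length S * K) K (sum g) ⟩
    K + length S * K + sum g                                   ∎
    where
    starred : Fin n → ℕ
    starred v = star c v * weight v

    regroup : ∀ x K y → x + (K + y) ≡ K + x + y
    regroup = solve-∀

    cov′ : ∀ v → Any (λ s → Close s v) S ⊎ weight v ≤ starred v + g v
    cov′ v with cov v
    ... | inj₁ (there s~v) = inj₁ s~v
    ... | inj₁ (here s~v)  = inj₂ (begin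
      weight v             ≡⟨ *-identityˡ (weight v) ⟨
      1 * weight v         ≤⟨ *-monoˡ-≤ (weight v) (hit s~v) ⟩
      starred v            ≤⟨ m≤m+n (starred v) (g v) ⟩
      starred v + g v      ∎)
    ... | inj₂ w≤g         = inj₂ (≤-trans w≤g (m≤n+m (g v) (starred v)))

  -- Graphs of diameter at most two

  -- Every vertex is reached from v by a walk of length two, except possibly v's
  -- neighbours; the d v walks that return to v make up for those.
  walks-from : (∀ u v → Close u v) → ∀ v → n ≤ 1 + ∑[ u < n ] (e v u * d u)
  walks-from close v = +-cancelʳ-≤ (d v) _ _ (begin
    n + d v
      ≡⟨ cong₂ _+_ (trans (∑-const n 1) (*-identityʳ n)) (∑-𝟙≟-* v (λ _ → d v)) ⟨
    ∑[ x < n ] 1 + ∑[ x < n ] (𝟙 (v ≟ᶠ x) * d v)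
      ≡⟨ ∑-distrib-+ {n} (λ _ → 1) _ ⟨
    ∑[ x < n ] (1 + 𝟙 (v ≟ᶠ x) * d v)
      ≤⟨ ∑-mono reach ⟩
    ∑[ x < n ] (𝟙 (v ≟ᶠ x) + e v x + walks x)
      ≡⟨ ∑-distrib-+ (λ x → 𝟙 (v ≟ᶠ x) + e v x) walks ⟩
    ∑[ x < n ] (𝟙 (v ≟ᶠ x) + e v x) + sum walks
      ≡⟨ cong₂ _+_ (∑-distrib-+ (λ x → 𝟙 (v ≟ᶠ x)) (e v)) ∑walks ⟩
    ∑[ x < n ] 𝟙 (v ≟ᶠ x) + sum (e v) + ∑[ u < n ] (e v u * d u)
      ≡⟨ cong (_+ ∑[ u < n ] (e v u * d u)) (cong₂ _+_ (∑-𝟙≟ v) (sym (degree≡∑ v))) ⟩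
    1 + d v + ∑[ u < n ] (e v u * d u)
      ≡⟨ cong suc (+-comm (d v) _) ⟩
    1 + ∑[ u < n ] (e v u * d u) + d v ∎)
    where
    walks : Fin n → ℕ
    walks x = ∑[ u < n ] (e v u * e u x)

    ∑walks : sum walks ≡ ∑[ u < n ] (e v u * d u)
    ∑walks = trans (∑-comm (λ x u → e v u * e u x)) (sum-cong-≗ λ u →
      trans (sym (*-distribˡ-sum (e v u) (e u))) (cong (e v u *_) (sym (degree≡∑ u))))

    closed-walks : walks v ≡ d v
    closed-walks = trans
      (sum-cong-≗ λ u → trans (cong (e v u *_) (e-sym u v)) (𝟙-*-idem (adj? G v u)))
      (sym (degree≡∑ v))

    reach : ∀ x → 1 + 𝟙 (v ≟ᶠ x) * d v ≤ 𝟙 (v ≟ᶠ x) + e v x + walks x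
    reach x with v ≟ᶠ x
    ... | yes refl = s≤s (begin
      d v + 0          ≡⟨ +-identityʳ (d v) ⟩
      d v              ≡⟨ closed-walks ⟨
      walks v          ≤⟨ m≤n+m (walks v) (e v v) ⟩
      e v v + walks v  ∎)
    ... | no v≢x with close v x
    ...   | inj₁ v≡x                  = contradiction v≡x v≢x
    ...   | inj₂ (inj₁ vx)            = ≤-trans (adj⇒1≤e vx) (m≤m+n (e v x) (walks x))
    ...   | inj₂ (inj₂ (u , vu , ux)) = begin
      1                ≤⟨ *-mono-≤ (adj⇒1≤e vu) (adj⇒1≤e ux) ⟩
      e v u * e u x    ≤⟨ f≤∑f (λ u → e v u * e u x) u ⟩
      walks x          ≤⟨ m≤n+m (walks x) (e v x) ⟩
      e v x + walks x  ∎

  -- Summing `walks-from` over all vertices gives `n * n ≤ n + Σ d²`. Adding `2 * Δ` per vertex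
  -- allows `convexity` to replace the squares by a linear term, which `handshake` evaluates.
  diameter-two : (∀ u v → Close u v) → (∀ v → 2 ≤ d v) →
    n * n + n * (2 * Δ) ≤ n + (Δ + 2) * (2 * m)
  diameter-two close 2≤d = begin
    n * n + n * (2 * Δ)
      ≡⟨ cong₂ _+_ (∑-const n n) (∑-const n (2 * Δ)) ⟨
    ∑[ v < n ] n + ∑[ u < n ] (2 * Δ)
      ≤⟨ +-monoˡ-≤ _ (∑-mono (walks-from close)) ⟩
    ∑[ v < n ] (1 + ∑[ u < n ] (e v u * d u)) + ∑[ u < n ] (2 * Δ)
      ≡⟨ cong (_+ ∑[ u < n ] (2 * Δ)) (trans (∑-distrib-+ {n} (λ _ → 1) _)
                            (cong₂ _+_ (trans (∑-const n 1) (*-identityʳ n)) ∑∑≡)) ⟩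
    n + ∑[ u < n ] (d u * d u) + ∑[ u < n ] (2 * Δ)
      ≡⟨ +-assoc n _ _ ⟩
    n + (∑[ u < n ] (d u * d u) + ∑[ u < n ] (2 * Δ))
      ≡⟨ cong (n +_) (∑-distrib-+ (λ u → d u * d u) _) ⟨
    n + ∑[ u < n ] (d u * d u + 2 * Δ)
      ≤⟨ +-monoʳ-≤ n (∑-mono λ u → convexity (2≤d u) (degree≤Δ u)) ⟩
    n + ∑[ u < n ] ((Δ + 2) * d u)
      ≡⟨ cong (n +_) (*-distribˡ-sum (Δ + 2) d) ⟨
    n + (Δ + 2) * sum d
      ≡⟨ cong (λ k → n + (Δ + 2) * k) handshake ⟩
    n + (Δ + 2) * (2 * m) ∎
    where
    ∑∑≡ : ∑[ v < n ] ∑[ u < n ] (e v u * d u) ≡ ∑[ u < n ] (d u * d u)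
    -- Walks of length two are regrouped by their middle vertex `u`, which has `d u` choices on each
    -- side.
    ∑∑≡ = trans (∑-comm (λ v u → e v u * d u)) (sum-cong-≗ λ u →
      trans (sym (*-distribʳ-sum (d u) (λ v → e v u)))
            (cong (_* d u) (trans (sum-cong-≗ λ v → e-sym v u) (sym (degree≡∑ u)))))

  -- Choice of the packing

  weight≤Δ∸1 : ∀ {v} → 2 ≤ d v → weight v ≤ Δ ∸ 1
  weight≤Δ∸1 = ∸-monoʳ-≤ (suc Δ)

  ∑weight≤ : (∀ v → 2 ≤ d v) → sum weight ≤ n * (Δ ∸ 1)
  ∑weight≤ 2≤d = ≤-trans (∑-mono (weight≤Δ∸1 ∘ 2≤d)) (≤-reflexive (∑-const n (Δ ∸ 1)))

  EfficientPacking : Set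
  EfficientPacking = ∃ λ S → Packing S × sum weight ≤ length S * K

  -- Two vertices that are not `Close` form a sufficient packing. If there are none, the given
  -- vertex alone suffices, by the walk count.
  min-degree-two : n ≤ 7 → Fin n → (∀ v → 2 ≤ d v) → EfficientPacking
  min-degree-two n≤7 x 2≤d with any? (λ u → any? (λ v → ¬? (close? u v)))
  ... | yes (u , v , u≁v) = u ∷ v ∷ [] , (u≁v ∷ []) ∷ [] ∷ [] ,
    ≤-trans (∑weight≤ 2≤d) (two-balls n≤7 (≤-trans (2≤d x) (degree≤Δ x)))
  ... | no ¬far = x ∷ [] , [] ∷ [] , (begin
    sum weight  ≤⟨ one-ball {m = m} n≤7 ∑weight (∑weight≤ 2≤d) (diameter-two close 2≤d) ⟩
    K           ≡⟨ *-identityˡ K ⟨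
    1 * K       ∎)
    where
    close : ∀ u v → Close u v
    close u v = decidable-stable (close? u v) λ u≁v → ¬far (u , v , u≁v)

  module _ {S} (low : All (λ s → d s ≤ 1) S)
           (maximal : ∀ v → d v ≤ 1 → Any (λ s → Close s v) S) where

    covered? : ∀ v → Dec (Any (λ s → Close s v) S)
    covered? v = Any.any? (λ s → close? s v) S

    uncovered : ℕ
    uncovered = ∑[ v < n ] 𝟙 (¬? (covered? v))

    uncovered⇒2≤degree : ∀ v → ¬ Any (λ s → Close s v) S → 2 ≤ d v
    uncovered⇒2≤degree v ¬cov = ≰⇒> (¬cov ∘ maximal v)

    ∑weight≤uncovered : sum weight ≤ length S * K + uncovered * (Δ ∸ 1)
    ∑weight≤uncovered = ≤-trans (cover low (λ v → 𝟙 (¬? (covered? v)) * (Δ ∸ 1)) dichotomy)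
      (≤-reflexive (cong (length S * K +_) (sym (*-distribʳ-sum (Δ ∸ 1) (λ v → 𝟙 (¬? (covered? v)))))))
      where
      dichotomy : ∀ v → Any (λ s → Close s v) S ⊎ weight v ≤ 𝟙 (¬? (covered? v)) * (Δ ∸ 1)
      dichotomy v with covered? v
      ... | yes cov = inj₁ cov
      ... | no ¬cov = inj₂ (≤-trans (weight≤Δ∸1 (uncovered⇒2≤degree v ¬cov))
                                    (≤-reflexive (sym (*-identityˡ (Δ ∸ 1)))))

    -- Each uncovered vertex contributes at least 2 to the degree sum `2 * m`.
    uncovered≤size : uncovered ≤ m
    uncovered≤size = *-cancelˡ-≤ 2 (begin
      2 * uncovered                             ≡⟨ *-comm 2 uncovered ⟩
      uncovered * 2                             ≡⟨ *-distribʳ-sum 2 (λ v → 𝟙 (¬? (covered? v))) ⟩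
      ∑[ v < n ] (𝟙 (¬? (covered? v)) * 2)      ≤⟨ ∑-mono twice ⟩
      sum d                                     ≡⟨ handshake ⟩
      2 * m                                     ∎)
      where
      twice : ∀ v → 𝟙 (¬? (covered? v)) * 2 ≤ d v
      twice v with covered? v
      ... | yes _   = z≤n
      ... | no ¬cov = uncovered⇒2≤degree v ¬cov

  extend : n ≤ 7 → ∀ {S} → Packing S → All (λ s → d s ≤ 1) S →
    (∀ v → d v ≤ 1 → Any (λ s → Close s v) S) →
    ∀ x → ¬ Any (λ s → Close s x) S → EfficientPacking
  extend n≤7 {[]} S! low maximal x x∉ =
    -- With `S` empty, maximality would place a vertex of degree at most 1 in a ball around a member
    -- of `[]`.
    min-degree-two n≤7 x λ v → ≰⇒> λ d≤1 → case maximal v d≤1 of λ ()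
  extend n≤7 {S@(_ ∷ S′)} S! low maximal x x∉ =
    x ∷ S , All.map (_∘ close-sym) (¬Any⇒All¬ S x∉) ∷ S! ,
    one-more-ball (length S′) n≤7
      (≤-trans (uncovered⇒2≤degree low maximal x x∉) (degree≤Δ x))
      ∑weight (uncovered≤size low maximal) (∑weight≤uncovered low maximal)

  efficientPacking : n ≤ 7 → EfficientPacking
  efficientPacking n≤7
    with S , S! , low , maximal ← greedy (inj₁ refl) close-sym close? (λ v → d v ≤? 1) (allFin n)
    with any? (λ v → ¬? (Any.any? (λ s → close? s v) S))
  ... | yes (x , x∉) = extend n≤7 S! low (λ v → maximal (∈-allFin v)) x x∉
  ... | no ¬missed   = S , S! , (begin
    -- The balls miss no vertex, so nothing is left for `g` to pay.
    sum weight                   ≤⟨ cover low (λ _ → 0) (inj₁ ∘ covered) ⟩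
    length S * K + ∑[ v < n ] 0  ≡⟨ cong (length S * K +_) (sum-replicate-zero n) ⟩
    length S * K + 0             ≡⟨ +-identityʳ _ ⟩
    length S * K                 ∎)
    where
    covered : ∀ v → Any (λ s → Close s v) S
    covered v = decidable-stable (Any.any? (λ s → close? s v) S) λ ¬c → ¬missed (v , ¬c)

-- The inequality and the minimality of `H₂₂`

order≤7⇒satisfiesBound : ∀ G → order G ≤ 7 → SatisfiesBound G
order≤7⇒satisfiesBound G n≤7 =
  let _ , S! , W≤ = efficientPacking G n≤7 in packing⇒satisfiesBound G S! W≤

proposition6p1 : (∀ (G : Graph) → order G ≤ 7 → SatisfiesBound G)
    × order H₂₂ ≡ 8
    × ¬ SatisfiesBound H₂₂
    × (∀ (G : Graph) → ¬ SatisfiesBound G → order H₂₂ ≤ order G)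
proposition6p1 =
  order≤7⇒satisfiesBound , refl ,
  -- Decided by evaluation: `n = 8`, `m = 11` and `Δ = 4` give the bound 118/17, which is less than
  -- `τD H₂₂ = 7`.
  from-no (ℤ.+ τD H₂₂ ℚ./ 1 ℚ.≤? bound H₂₂) ,
  λ G ¬sat → ≰⇒> (¬sat ∘ order≤7⇒satisfiesBound G)
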